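{- Let $\varGamma=\{0,1,\dots,n\}\times\{0,1,\dots,n\}$, totally ordered lexicographically, and let $F:C(R_n)\to\varGamma$ be the edge-labeling of the rook monoid $R_n$ (with the Bruhat–Chevalley–Renner order) defined by $F((x,y))=(a_i,b_i)$ if $y$ covers $x$ by type 1 (at position $i$) and $F((x,y))=(a_i,a_j)$ if $y$ covers $x$ by type 2 (at positions $i<j$). Then $F$ is an $EL$-labeling of $R_n$. In particular, $R_n$ is lexicographically ($EL$-)shellable.
   Context: $R_n$ (the rook monoid) is the set of $n\times n$ $0/1$ matrices with at most one $1$ in each row and each column. An element $x=(x_{ij})$ is encoded as a sequence $(a_1,\dots,a_n)$ with $a_j=0$ if column $j$ of $x$ is zero and $a_j=i$ if $x_{ij}=1$. The Bruhat–Chevalley–Renner order on $R_n$ is defined by $r\le t$ iff $BrB\subseteq \overline{BtB}$ (Zariski closure in the $n\times n$ matrices over an algebraically closed field, $B$ the invertible upper triangular matrices); equivalently, it is the smallest partial order on $R_n$ such that $x=(a_1,\dots,a_n)\le y=(b_1,\dots,b_n)$ whenever either (1) there is $i$ with $b_i>a_i$ and $b_k=a_k$ for $k\ne i$, or (2) there are $i<j$ with $b_i=a_j$, $b_j=a_i$, $b_i>b_j$, and $b_k=a_k$ for $k\notin\{i,j\}$. This poset is graded with rank function $\ell(x)=\sum_i a_i+\mathrm{inv}(x)$, where $\mathrm{inv}(x)=|\{(i,j): i<j,\ a_i>a_j\}|$. $C(R_n)$ is the set of pairs $(x,y)$ with $y$ covering $x$. A covering $(x,y)$ is of type 1 if $x,y$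 differ only in one position $i$ with $a_i<b_i$; it is of type 2 if there are $i<j$ with $a_i<a_j$, $b_i=a_j$, $b_j=a_i$ and $b_k=a_k$ for $k\notin\{i,j\}$; every covering is of exactly one of these types. For a graded poset $P$ and a totally ordered set $\varGamma$, an edge-labeling $f:C(P)\to\varGamma$ assigns to a maximal chain $\mathfrak c: x=x_0<x_1<\dots<x_k=y$ of an interval its Jordan–Hölder sequence $f(\mathfrak c)=(f((x_0,x_1)),\dots,f((x_{k-1},x_k)))\in\varGamma^k$, ordered lexicographically; $\mathfrak c$ is increasing if $f((x_0,x_1))\le\dots\le f((x_{k-1},x_k))$. $f$ is an $EL$-labeling if for every interval $[x,y]$ of rank $k>0$ there is a unique increasing maximal chain, and its Jordan–Hölder sequence is the lexicographically smallest among those of all maximal chains of $[x,y]$. -}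

module Defs where

open import Data.Nat using (ℕ; zero; suc; _≤_; _<_; _≟_)
open import Data.Fin as F using (Fin)
open import Data.Vec using (Vec; lookup)
open import Data.List using (List; []; _∷_; filter)
open import Data.Fin.Properties using () renaming (_≟_ to _≟F_)
open import Data.List using (allFin)
open import Data.Product using (Σ; ∃; ∃-syntax; _×_; _,_)
open import Data.Sum using (_⊎_)
open import Relation.Nullary using (¬_)
open import Relation.Nullary.Decidable using (¬?)
open import Relation.Binary.PropositionalEquality using (_≡_; _≢_)
open import Relation.Binary.Construct.Closure.ReflexiveTransitive using (Star)
open import Data.List.Relation.Unary.Linked using (Linked)

-- Elements of R_n are encoded as sequences (a_1,...,a_n) (a Vec of length n,
-- position j is index j-1 : Fin n), a_j = 0 for a zero column, a_j = i for x_ij = 1.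
-- IsRook: entries lie in {0,...,n} and nonzero entries are pairwise distinct
-- (at most one 1 in each row; each column has at most one 1 by the encoding).
IsRook : (n : ℕ) → Vec ℕ n → Set
IsRook n a = (∀ i → lookup a i ≤ n)
           × (∀ i j → lookup a i ≡ lookup a j → lookup a i ≢ 0 → i ≡ j)

Gen1 : (n : ℕ) → Vec ℕ n → Vec ℕ n → Set
Gen1 n a b = ∃[ i ] (lookup a i < lookup b i × (∀ k → k ≢ i → lookup b k ≡ lookup a k))

Gen2 : (n : ℕ) → Vec ℕ n → Vec ℕ n → Set
Gen2 n a b = ∃[ i ] ∃[ j ] (i F.< j × lookup b i ≡ lookup a j × lookup b j ≡ lookup a i
             × lookup b j < lookup b i
             × (∀ k → k ≢ i → k ≢ j → lookup b k ≡ lookup a k))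

Step : (n : ℕ) → Vec ℕ n → Vec ℕ n → Set
Step n a b = IsRook n a × IsRook n b × (Gen1 n a b ⊎ Gen2 n a b)

-- Bruhat–Chevalley–Renner order: the smallest partial order on R_n containing
-- the generating relations, i.e. the reflexive-transitive closure of Step
-- (restricted to elements of R_n).
LeB : (n : ℕ) → Vec ℕ n → Vec ℕ n → Set
LeB n a b = Star (Step n) a b

LtB : (n : ℕ) → Vec ℕ n → Vec ℕ n → Set
LtB n a b = LeB n a b × a ≢ b

Covers : (n : ℕ) → Vec ℕ n → Vec ℕ n → Set
Covers n x y = IsRook n x × IsRook n y × LtB n x y
             × (∀ z → IsRook n z → LtB n x z → LtB n z y → Data.Empty.⊥)
  where import Data.Empty

-- Label set Γ = {0..n} × {0..n} (as ℕ × ℕ; the labels produced lie in {0..n}²),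
-- ordered lexicographically.
Γ : Set
Γ = ℕ × ℕ

_≤Γ_ : Γ → Γ → Set
(p , q) ≤Γ (r , s) = p < r ⊎ (p ≡ r × q ≤ s)

_<Γ_ : Γ → Γ → Set
(p , q) <Γ (r , s) = p < r ⊎ (p ≡ r × q < s)

data _≤Lex_ : List Γ → List Γ → Set where
  []≤    : ∀ {ys} → [] ≤Lex ys
  here   : ∀ {x y xs ys} → x <Γ y → (x ∷ xs) ≤Lex (y ∷ ys)
  there  : ∀ {x xs ys} → xs ≤Lex ys → (x ∷ xs) ≤Lex (x ∷ ys)

diffPos : (n : ℕ) → Vec ℕ n → Vec ℕ n → List (Fin n)
diffPos n a b = filter (λ i → ¬? (lookup a i ≟ lookup b i)) (allFin n)

-- The labeling F: for a covering (x,y) of type 1 at position i (x,y differ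
-- exactly at i) the label is (a_i, b_i); for type 2 at positions i<j (x,y
-- differ exactly at i and j) the label is (a_i, a_j).  Other pairs (which are
-- never coverings) get an irrelevant default label.
FLabel : (n : ℕ) → Vec ℕ n → Vec ℕ n → Γ
FLabel n a b with diffPos n a b
... | i ∷ []     = lookup a i , lookup b i
... | i ∷ j ∷ [] = lookup a i , lookup a j
... | _          = 0 , 0

-- Maximal chain x = x_0 ⋖ x_1 ⋖ ... ⋖ x_k = y, represented by the list x_1,...,x_k.
MaxChain : (n : ℕ) → Vec ℕ n → List (Vec ℕ n) → Vec ℕ n → Set
MaxChain n x []       y = x ≡ y
MaxChain n x (z ∷ zs) y = Covers n x z × MaxChain n z zs y

JH : {n : ℕ} → (Vec ℕ n → Vec ℕ n → Γ) → Vec ℕ n → List (Vec ℕ n) → List Γ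
JH f x []       = []
JH f x (z ∷ zs) = f x z ∷ JH f z zs

Increasing : List Γ → Set
Increasing = Linked _≤Γ_

IsELLabeling : (n : ℕ) → (Vec ℕ n → Vec ℕ n → Γ) → Set
IsELLabeling n f =
  ∀ x y → IsRook n x → IsRook n y → LtB n x y →
  Σ (List (Vec ℕ n)) λ c →
      MaxChain n x c y
    × Increasing (JH f x c)
    × (∀ c′ → MaxChain n x c′ y → Increasing (JH f x c′) → c′ ≡ c)
    × (∀ c′ → MaxChain n x c′ y → JH f x c ≤Lex JH f x c′)

{-# OPTIONS --safe #-}

-- Write C x k v for the number of entries ≤ v among the first k entries of x.  The order is
-- dominance: x ≤ y iff C x k v ≥ C y k v for all k and v.  For x < y let p be the least value
-- with C x (-) p ≠ C y (-) p, call k a gap if C x k p > C y k p, and let q be the least value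
-- above p that x carries at a position preceded by a gap.  Exchanging q with the last p before
-- it gives the atom of [x , y] with the least label (p , q).  Taking it repeatedly gives a chain
-- with increasing labels, which is lexicographically least because labels determine atoms.
-- Any other atom leaves (p , q), or a smaller label, available above it, so an increasing chain
-- always takes the least atom.
module Submission where

open import Defs
open import Data.Nat using (ℕ; zero; suc; _+_; _∸_; _≤_; _<_; _≤?_; _<?_; _≟_; z≤n; s≤s)
open import Data.Nat.Properties
open import Algebra.Properties.CommutativeSemigroup +-commutativeSemigroup
  using (interchange; xy∙z≈xz∙y)
open import Data.Empty using (⊥)
open import Data.Fin as Fin using (Fin; toℕ; fromℕ<)
import Data.Fin.Properties as Fin
open import Data.List as List using (List; []; _∷_; filter)
open import Data.List.Properties using (filter-accept; filter-reject; filter-none)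
open import Data.List.Relation.Unary.All.Properties using (tabulate⁺)
open import Data.List.Relation.Unary.Linked using ([]; [-]; _∷_)
open import Data.Nat.Induction using (<-rec; <-wellFounded)
open import Data.Product using (∃-syntax; _×_; _,_; proj₁; proj₂)
import Data.Product.Properties as Product
open import Data.Sum using (_⊎_; inj₁; inj₂)
open import Data.Vec using (Vec; []; _∷_; lookup; tabulate)
open import Data.Vec.Properties using (lookup∘tabulate; ≡-dec)
open import Function using (_∘_; id)
open import Induction.WellFounded using (Acc; acc)
open import Level using (0ℓ)
open import Relation.Binary using (tri<; tri≈; tri>)
open import Relation.Binary.Construct.Closure.ReflexiveTransitive using (ε; _◅_)
open import Relation.Binary.PropositionalEquality hiding ([_])
open import Relation.Nullary using (¬_; Dec; yes; no; contradiction)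
open import Relation.Nullary.Decidable using (_×-dec_; ¬?; decidable-stable)
open import Relation.Unary using (Pred; Decidable)

-- Least witnesses and bounded sums

least : ∀ {P : Pred ℕ 0ℓ} → Decidable P → ∀ m → P m →
        ∃[ q ] P q × (∀ {v} → P v → q ≤ v)
least {P} P? = <-rec (λ m → P m → ∃[ q ] P q × (∀ {v} → P v → q ≤ v)) search
  where
  search : ∀ m → (∀ {k} → k < m → P k → ∃[ q ] P q × (∀ {v} → P v → q ≤ v)) →
           P m → ∃[ q ] P q × (∀ {v} → P v → q ≤ v)
  search m rec pm with anyUpTo? P? m
  ... | yes (k , k<m , pk) = rec k<m pk
  ... | no ¬below = m , pm , λ {v} pv → ≮⇒≥ λ v<m → ¬below (v , v<m , pv)

sumBelow : (ℕ → ℕ) → ℕ → ℕ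
sumBelow f zero    = 0
sumBelow f (suc m) = sumBelow f m + f m

sumBelow-mono-≤ : ∀ {f g} m → (∀ {t} → t < m → f t ≤ g t) → sumBelow f m ≤ sumBelow g m
sumBelow-mono-≤ zero    f≤g = z≤n
sumBelow-mono-≤ (suc m) f≤g =
  +-mono-≤ (sumBelow-mono-≤ m (f≤g ∘ m<n⇒m<1+n)) (f≤g (n<1+n m))

sumBelow-cong : ∀ {f g} m → (∀ {t} → t < m → f t ≡ g t) → sumBelow f m ≡ sumBelow g m
sumBelow-cong zero    f≡g = refl
sumBelow-cong (suc m) f≡g =
  cong₂ _+_ (sumBelow-cong m (f≡g ∘ m<n⇒m<1+n)) (f≡g (n<1+n m))

sumBelow-mono-< : ∀ {f g} m → (∀ {t} → t < m → f t ≤ g t) →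
                  ∀ {j} → j < m → f j < g j → sumBelow f m < sumBelow g m
sumBelow-mono-< (suc m) f≤g {j} j<1+m fj<gj with m<1+n⇒m<n∨m≡n j<1+m
... | inj₁ j<m  = +-mono-<-≤ (sumBelow-mono-< m (f≤g ∘ m<n⇒m<1+n) j<m fj<gj) (f≤g (n<1+n m))
... | inj₂ refl = +-mono-≤-< (sumBelow-mono-≤ m (f≤g ∘ m<n⇒m<1+n)) fj<gj

-- Indicators and prefix counts

[_≤_] : ℕ → ℕ → ℕ
[ a ≤ v ] with a ≤? v
... | yes _ = 1
... | no  _ = 0

[≤]≡1 : ∀ {a v} → a ≤ v → [ a ≤ v ] ≡ 1
[≤]≡1 {a} {v} a≤v with a ≤? v
... | yes _   = refl
... | no  a≰v = contradiction a≤v a≰v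

[≤]≡0 : ∀ {a v} → v < a → [ a ≤ v ] ≡ 0
[≤]≡0 {a} {v} v<a with a ≤? v
... | yes a≤v = contradiction a≤v (<⇒≱ v<a)
... | no  _   = refl

[≤]≡1⇒≤ : ∀ {a v} → [ a ≤ v ] ≡ 1 → a ≤ v
[≤]≡1⇒≤ {a} {v} eq with a ≤? v
... | yes a≤v = a≤v

[≤]≤1 : ∀ a v → [ a ≤ v ] ≤ 1
[≤]≤1 a v with a ≤? v
... | yes _ = ≤-refl
... | no  _ = z≤n

[≤]-monoʳ : ∀ a {v w} → v ≤ w → [ a ≤ v ] ≤ [ a ≤ w ]
[≤]-monoʳ a {v} {w} v≤w with a ≤? v
... | yes a≤v = ≤-reflexive (sym ([≤]≡1 (≤-trans a≤v v≤w)))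
... | no  _   = z≤n

-- The `C x k v` of the overview. Sequences are functions on all of ℕ, of which only the values at
-- positions below `n` matter.
count : (ℕ → ℕ) → ℕ → ℕ → ℕ
count x k v = sumBelow (λ t → [ x t ≤ v ]) k

-- Rook sequences, exchanges and labels

Rook : ℕ → (ℕ → ℕ) → Set
Rook n x = (∀ {t} → t < n → x t ≤ n)
         × (∀ {s t} → s < n → t < n → x s ≡ x t → x s ≢ 0 → s ≡ t)

-- The values of {0..n} that do not occur in x are regarded as sitting together at the
-- extra position n.  A covering of type 1 then exchanges position i with position n.
At : ℕ → (ℕ → ℕ) → ℕ → ℕ → Set
At n x t v = (t < n × x t ≡ v) ⊎ (t ≡ n × v ≤ n × (∀ {s} → s < n → x s ≢ v))

infix 4 _⊢_⊒_
_⊢_⊒_ : ℕ → (ℕ → ℕ) → (ℕ → ℕ) → Set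
n ⊢ x ⊒ y = ∀ {k} v → k ≤ n → count y k v ≤ count x k v

-- Treats both types at once: `j < n` exchanges two entries, `j ≡ n` raises the entry at `i` from
-- `p` to `q`. Hence the guards `j < n` on the conditions at `j`.
record Swap (n : ℕ) (x z : ℕ → ℕ) (i j p q : ℕ) : Set where
  field
    i<j  : i < j
    j≤n  : j ≤ n
    p<q  : p < q
    xi≡p : x i ≡ p
    zi≡q : z i ≡ q
    xj≡q : j < n → x j ≡ q
    zj≡p : j < n → z j ≡ p
    same : ∀ {t} → t < n → t ≢ i → t ≢ j → z t ≡ x t

  i<n : i < n
  i<n = <-≤-trans i<j j≤n

  count-left : ∀ {k} v → k ≤ i → count z k v ≡ count x k v
  count-left v k≤i = sumBelow-cong _ λ t<k →
    cong [_≤ v ] (same (<-trans (<-≤-trans t<k k≤i) i<n)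
                       (<⇒≢ (<-≤-trans t<k k≤i))
                       (<⇒≢ (<-trans (<-≤-trans t<k k≤i) i<j)))

  -- The prefix contains `i` but not `j`, so it has traded one `p` for one `q`. The additive form
  -- avoids truncated subtraction.
  count-between : ∀ {k} v → i < k → k ≤ j → count z k v + [ p ≤ v ] ≡ count x k v + [ q ≤ v ]
  count-between {suc k} v i<1+k k<j with m<1+n⇒m<n∨m≡n i<1+k
  ... | inj₁ i<k = begin
    count z k v + [ z k ≤ v ] + [ p ≤ v ]  ≡⟨ xy∙z≈xz∙y (count z k v) _ _ ⟩
    count z k v + [ p ≤ v ] + [ z k ≤ v ]
      ≡⟨ cong₂ _+_ (count-between v i<k (<⇒≤ k<j))
                   (cong [_≤ v ] (same (<-≤-trans k<j j≤n) (>⇒≢ i<k) (<⇒≢ k<j))) ⟩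
    count x k v + [ q ≤ v ] + [ x k ≤ v ]  ≡⟨ xy∙z≈xz∙y (count x k v) _ _ ⟩
    count x k v + [ x k ≤ v ] + [ q ≤ v ]  ∎
    where open ≡-Reasoning
  ... | inj₂ refl = begin
    count z i v + [ z i ≤ v ] + [ p ≤ v ]
      ≡⟨ cong₂ (λ c a → c + [ a ≤ v ] + [ p ≤ v ]) (count-left v ≤-refl) zi≡q ⟩
    count x i v + [ q ≤ v ] + [ p ≤ v ]    ≡⟨ xy∙z≈xz∙y (count x i v) _ _ ⟩
    count x i v + [ p ≤ v ] + [ q ≤ v ]
      ≡⟨ cong (λ a → count x i v + [ a ≤ v ] + [ q ≤ v ]) xi≡p ⟨
    count x i v + [ x i ≤ v ] + [ q ≤ v ]  ∎
    where open ≡-Reasoning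

  count-right : ∀ {k} v → j < k → k ≤ n → count z k v ≡ count x k v
  count-right {suc k} v j<1+k k<n with m<1+n⇒m<n∨m≡n j<1+k
  ... | inj₁ j<k  = cong₂ _+_ (count-right v j<k (<⇒≤ k<n))
                              (cong [_≤ v ] (same k<n (>⇒≢ (<-trans i<j j<k)) (>⇒≢ j<k)))
  ... | inj₂ refl = begin
    count z j v + [ z j ≤ v ]  ≡⟨ cong (λ a → count z j v + [ a ≤ v ]) (zj≡p k<n) ⟩
    count z j v + [ p ≤ v ]    ≡⟨ count-between v i<j ≤-refl ⟩
    count x j v + [ q ≤ v ]    ≡⟨ cong (λ a → count x j v + [ a ≤ v ]) (xj≡q k<n) ⟨
    count x j v + [ x j ≤ v ]  ∎
    where open ≡-Reasoning

  count-inside : ∀ {k v} → i < k → k ≤ j → p ≤ v → v < q → suc (count z k v) ≡ count x k v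
  count-inside {k} {v} i<k k≤j p≤v v<q = begin
    suc (count z k v)        ≡⟨ +-comm 1 _ ⟩
    count z k v + 1          ≡⟨ cong (count z k v +_) ([≤]≡1 p≤v) ⟨
    count z k v + [ p ≤ v ]  ≡⟨ count-between v i<k k≤j ⟩
    count x k v + [ q ≤ v ]  ≡⟨ cong (count x k v +_) ([≤]≡0 v<q) ⟩
    count x k v + 0          ≡⟨ +-identityʳ _ ⟩
    count x k v              ∎
    where open ≡-Reasoning

  -- The rectangle of pairs `(k , v)` on which the exchange lowers the count, by exactly one.
  -- Exchanges are compared below through their rectangles.
  Inside : ℕ → ℕ → Set
  Inside k v = (i < k × k ≤ j) × (p ≤ v × v < q)

  inside? : ∀ k v → Dec (Inside k v)
  inside? k v = ((i <? k) ×-dec (k ≤? j)) ×-dec ((p ≤? v) ×-dec (v <? q))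

  count-outside : ∀ {k v} → k ≤ n → ¬ Inside k v → count z k v ≡ count x k v
  count-outside {k} {v} k≤n ¬in with i <? k | k ≤? j | p ≤? v | v <? q
  ... | no i≮k | _ | _ | _ = count-left v (≮⇒≥ i≮k)
  ... | yes _  | no k≰j | _ | _ = count-right v (≰⇒> k≰j) k≤n
  ... | yes i<k | yes k≤j | yes p≤v | yes v<q = contradiction ((i<k , k≤j) , p≤v , v<q) ¬in
  -- Above or below the rectangle the indicators of `p` and `q` coincide: both are 0 for `v < p` and
  -- both are 1 for `q ≤ v`, so they cancel.
  ... | yes i<k | yes k≤j | no p≰v | _ =
    +-cancelʳ-≡ 0 _ _ (subst₂ (λ a b → count z k v + a ≡ count x k v + b)
      ([≤]≡0 (≰⇒> p≰v)) ([≤]≡0 (<-trans (≰⇒> p≰v) p<q)) (count-between v i<k k≤j))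
  ... | yes i<k | yes k≤j | yes _ | no v≮q =
    +-cancelʳ-≡ 1 _ _ (subst₂ (λ a b → count z k v + a ≡ count x k v + b)
      ([≤]≡1 (≤-trans (<⇒≤ p<q) (≮⇒≥ v≮q))) ([≤]≡1 (≮⇒≥ v≮q)) (count-between v i<k k≤j))

  inside : ∀ {k v} → k ≤ n → count z k v < count x k v → Inside k v
  inside {k} {v} k≤n lt =
    decidable-stable (inside? k v) λ ¬in → <⇒≢ lt (count-outside k≤n ¬in)

  count-drop : ∀ {k v} → Inside k v → count z k v < count x k v
  count-drop ((i<k , k≤j) , p≤v , v<q) = ≤-reflexive (count-inside i<k k≤j p≤v v<q)

  swap-⊒ : n ⊢ x ⊒ z
  swap-⊒ {k} v k≤n with inside? k v
  ... | yes in′ = <⇒≤ (count-drop in′)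
  ... | no ¬in  = ≤-reflexive (count-outside k≤n ¬in)

  at-forward : ∀ {t v} → v ≢ p → v ≢ q → At n x t v → At n z t v
  at-forward v≢p v≢q (inj₁ (t<n , refl)) = inj₁ (t<n ,
    same t<n (λ { refl → v≢p xi≡p }) (λ { refl → v≢q (xj≡q t<n) }))
  at-forward {v = v} v≢p v≢q (inj₂ (t≡n , v≤n , unused)) = inj₂ (t≡n , v≤n , unused′)
    where
    unused′ : ∀ {s} → s < n → z s ≢ v
    unused′ {s} s<n zs≡v with s ≟ i | s ≟ j
    ... | yes refl | _        = v≢q (trans (sym zs≡v) zi≡q)
    ... | no _     | yes refl = v≢p (trans (sym zs≡v) (zj≡p s<n))
    ... | no s≢i   | no s≢j   = unused s<n (trans (sym (same s<n s≢i s≢j)) zs≡v)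

  at-backward : ∀ {t v} → v ≢ p → v ≢ q → At n z t v → At n x t v
  at-backward v≢p v≢q (inj₁ (t<n , refl)) = inj₁ (t<n ,
    sym (same t<n (λ { refl → v≢q zi≡q }) (λ { refl → v≢p (zj≡p t<n) })))
  at-backward {v = v} v≢p v≢q (inj₂ (t≡n , v≤n , unused)) = inj₂ (t≡n , v≤n , unused′)
    where
    unused′ : ∀ {s} → s < n → x s ≢ v
    unused′ {s} s<n xs≡v with s ≟ i | s ≟ j
    ... | yes refl | _        = v≢p (trans (sym xs≡v) xi≡p)
    ... | no _     | yes refl = v≢q (trans (sym xs≡v) (xj≡q s<n))
    ... | no s≢i   | no s≢j   = unused s<n (trans (same s<n s≢i s≢j) xs≡v)

record Cover (n : ℕ) (x z : ℕ → ℕ) (p q : ℕ) : Set where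
  field
    i j     : ℕ
    swap    : Swap n x z i j p q
    at-j    : At n x j q
    last-p  : ∀ {t} → i < t → t < j → x t ≢ p
    between : ∀ {t v} → i < t → t ≤ j → At n x t v → p < v → q ≤ v

  open Swap swap public

-- The pair `(p , q)` of the overview: `agree` and `gap` make `p` the least level with a gap,
-- `minimal` makes `q` least. The position of `p` is left out and recovered by `lastOccurrence`.
record MinLabel (n : ℕ) (x y : ℕ → ℕ) (p q : ℕ) : Set where
  field
    agree   : ∀ {v k} → v < p → k ≤ n → count x k v ≡ count y k v
    p<q     : p < q
    j       : ℕ
    at-j    : At n x j q
    gap     : count y j p < count x j p
    minimal : ∀ {t v} → At n x t v → p < v → count y t p < count x t p → q ≤ v

-- What counts determine and how they grow with the threshold

count-agree : ∀ x y {k v} → count x k v ≡ count y k v → count x (suc k) v ≡ count y (suc k) v →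
              x k ≤ v → y k ≤ v
count-agree x y {k} {v} eq eq′ xk≤v = [≤]≡1⇒≤ (+-cancelˡ-≡ (count x k v) _ _ (begin
  count x k v + [ y k ≤ v ]  ≡⟨ cong (_+ [ y k ≤ v ]) eq ⟩
  count y k v + [ y k ≤ v ]  ≡⟨ eq′ ⟨
  count x k v + [ x k ≤ v ]  ≡⟨ cong (count x k v +_) ([≤]≡1 xk≤v) ⟩
  count x k v + 1            ∎))
  where open ≡-Reasoning

-- Consecutive prefix counts differ by one indicator, so equal counts give equal indicators. The
-- thresholds `y t` and `x t` then yield the two inequalities.
count-injective : ∀ {n x y} → (∀ {k} v → k ≤ n → count x k v ≡ count y k v) →
                  ∀ {t} → t < n → x t ≡ y t
count-injective {x = x} {y} eq {t} t<n = ≤-antisym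
  (count-agree y x (sym (eq _ (<⇒≤ t<n))) (sym (eq _ t<n)) ≤-refl)
  (count-agree x y (eq _ (<⇒≤ t<n)) (eq _ t<n) ≤-refl)

count-full : ∀ {x n} → ∀ k → (∀ {t} → t < k → x t ≤ n) → count x k n ≡ k
count-full zero    x≤n = refl
count-full (suc k) x≤n =
  trans (cong₂ _+_ (count-full k (x≤n ∘ m<n⇒m<1+n)) ([≤]≡1 (x≤n (n<1+n k)))) (+-comm k 1)

[≤]-suc : ∀ {a v} → a ≢ suc v → [ a ≤ suc v ] ≡ [ a ≤ v ]
[≤]-suc {a} {v} a≢1+v with a ≤? v
... | yes a≤v = [≤]≡1 (m≤n⇒m≤1+n a≤v)
... | no  a≰v = [≤]≡0 (≤∧≢⇒< (≰⇒> a≰v) (a≢1+v ∘ sym))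

count-suc-used : ∀ {x n t v} → t < n → x t ≡ suc v → count x n v < count x n (suc v)
count-suc-used {x} {n} {v = v} t<n xt≡1+v = sumBelow-mono-< n (λ {s} _ → [≤]-monoʳ (x s) (n≤1+n v)) t<n
  (≤-reflexive (trans (cong suc ([≤]≡0 (≤-reflexive (sym xt≡1+v)))) (sym ([≤]≡1 (≤-reflexive xt≡1+v)))))

module _ {n : ℕ} where

  -- Raising the threshold admits only entries equal to `suc v`, and a positive value occurs at most
  -- once in a rook sequence.
  count-suc-≤ : ∀ {x} → Rook n x → ∀ k v → k ≤ n → count x k (suc v) ≤ suc (count x k v)
  count-suc-≤ rx zero v k≤n = z≤n
  count-suc-≤ {x} rx@(_ , inj) (suc k) v k<n with x k ≟ suc v
  ... | no xk≢1+v  = +-mono-≤ (count-suc-≤ rx k v (<⇒≤ k<n)) (≤-reflexive ([≤]-suc xk≢1+v))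
  ... | yes xk≡1+v = begin
    count x k (suc v) + [ x k ≤ suc v ]  ≤⟨ +-mono-≤ (≤-reflexive fresh) ([≤]≤1 _ _) ⟩
    count x k v + 1                      ≡⟨ +-comm _ 1 ⟩
    suc (count x k v)                    ≤⟨ s≤s (m≤m+n _ _) ⟩
    suc (count x (suc k) v)              ∎
    where
    open ≤-Reasoning
    fresh : count x k (suc v) ≡ count x k v
    fresh = sumBelow-cong k λ t<k → [≤]-suc λ xt≡1+v → <⇒≢ t<k
      (inj (<-trans t<k k<n) k<n (trans xt≡1+v (sym xk≡1+v)) λ xt≡0 → 0≢1+n (trans (sym xt≡0) xt≡1+v))

  Used : (ℕ → ℕ) → ℕ → Set
  Used x v = ∃[ t ] t < n × x t ≡ v

  used? : ∀ x v → Dec (Used x v)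
  used? x v = anyUpTo? (λ t → x t ≟ v) n

  at? : ∀ x t v → Dec (At n x t v)
  at? x t v with t <? n | x t ≟ v | t ≟ n | v ≤? n | used? x v
  ... | yes t<n | yes xt≡v | _ | _ | _ = yes (inj₁ (t<n , xt≡v))
  ... | yes t<n | no xt≢v | _ | _ | _ = no λ { (inj₁ (_ , xt≡v)) → xt≢v xt≡v
                                             ; (inj₂ (refl , _)) → <-irrefl refl t<n }
  ... | no _ | _ | yes t≡n | yes v≤n | no ¬used = yes (inj₂ (t≡n , v≤n , λ s<n xs≡v → ¬used (_ , s<n , xs≡v)))
  ... | no t≮n | _ | no t≢n | _ | _ = no λ { (inj₁ (t<n , _)) → t≮n t<n
                                           ; (inj₂ (t≡n , _)) → t≢n t≡n }
  ... | no t≮n | _ | yes _ | no v≰n | _ = no λ { (inj₁ (t<n , _)) → t≮n t<n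
                                               ; (inj₂ (_ , v≤n , _)) → v≰n v≤n }
  ... | no t≮n | _ | yes _ | yes _ | yes (_ , s<n , xs≡v) =
    no λ { (inj₁ (t<n , _)) → t≮n t<n ; (inj₂ (_ , _ , unused)) → unused s<n xs≡v }

  at-position≤ : ∀ {x t v} → At n x t v → t ≤ n
  at-position≤ (inj₁ (t<n , _)) = <⇒≤ t<n
  at-position≤ (inj₂ (refl , _)) = ≤-refl

  at-value≤ : ∀ {x t v} → Rook n x → At n x t v → v ≤ n
  at-value≤ rx (inj₁ (t<n , refl)) = proj₁ rx t<n
  at-value≤ rx (inj₂ (_ , v≤n , _)) = v≤n

  at-unique : ∀ {x s t v} → Rook n x → v ≢ 0 → At n x s v → At n x t v → s ≡ t
  at-unique rx v≢0 (inj₁ (s<n , refl)) (inj₁ (t<n , eq)) = proj₂ rx s<n t<n (sym eq) v≢0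
  at-unique rx v≢0 (inj₁ (s<n , eq)) (inj₂ (_ , _ , unused)) = contradiction eq (unused s<n)
  at-unique rx v≢0 (inj₂ (_ , _ , unused)) (inj₁ (t<n , eq)) = contradiction eq (unused t<n)
  at-unique rx v≢0 (inj₂ (s≡n , _)) (inj₂ (t≡n , _)) = trans s≡n (sym t≡n)

  -- At each new threshold `y` gains at most one entry, while `x` gains at least one because the
  -- value is used.
  count-used-range : ∀ {x y p} → Rook n y → ∀ d → (∀ {v} → p < v → v ≤ d + p → Used x v) →
                     count y n (d + p) + count x n p ≤ count x n (d + p) + count y n p
  count-used-range {x} {y} {p} ry zero used = ≤-reflexive (+-comm (count y n p) _)
  count-used-range {x} {y} {p} ry (suc d) used with used (s≤s (m≤n+m p d)) ≤-refl
  ... | _ , t<n , xt≡ = begin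
    count y n (suc (d + p)) + count x n p      ≤⟨ +-monoˡ-≤ _ (count-suc-≤ ry n (d + p) ≤-refl) ⟩
    suc (count y n (d + p) + count x n p)
      ≤⟨ s≤s (count-used-range ry d (λ p<v v≤ → used p<v (m≤n⇒m≤1+n v≤))) ⟩
    suc (count x n (d + p) + count y n p)      ≤⟨ +-monoˡ-≤ _ (count-suc-used t<n xt≡) ⟩
    count x n (suc (d + p)) + count y n p      ∎
    where open ≤-Reasoning

  count-used-between : ∀ {x y p v} → Rook n y → p ≤ v → (∀ {w} → p < w → w ≤ v → Used x w) →
                       count y n v + count x n p ≤ count x n v + count y n p
  count-used-between {x} {y} {p} {v} ry p≤v used =
    subst (λ w → count y n w + count x n p ≤ count x n w + count y n p) (m∸n+n≡m p≤v)
      (count-used-range ry (v ∸ p) (λ {w} p<w w≤ → used p<w (subst (w ≤_) (m∸n+n≡m p≤v) w≤)))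

  -- Existence of the minimal label and of its exchange

  module _ {x y : ℕ → ℕ} (rx : Rook n x) (ry : Rook n y) (x⊒y : n ⊢ x ⊒ y) where

    -- The values `v` competing to be the `q` of level `p`.
    Candidate : ℕ → ℕ → ℕ → Set
    Candidate p t v = At n x t v × p < v × count y t p < count x t p

    candidate? : ∀ p t v → Dec (Candidate p t v)
    candidate? p t v = at? x t v ×-dec ((p <? v) ×-dec (count y t p <? count x t p))

    candidate-at-end : ∀ {p} → p ≤ n → count y n p < count x n p → ∃[ t ] ∃[ v ] Candidate p t v
    candidate-at-end {p} p≤n gap with anyUpTo? (λ v → (p <? v) ×-dec ¬? (used? x v)) (suc n)
    ... | yes (v , v<1+n , p<v , ¬used) =
      n , v , inj₂ (refl , m<1+n⇒m≤n v<1+n , λ s<n xs≡v → ¬used (_ , s<n , xs≡v)) , p<v , gap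
    -- If `x` used every value in `(p , n]`, it would have at least as many entries there as `y`.
    -- Both have `n` entries in all, so `x` could not have more entries up to `p`.
    ... | no ¬unused = contradiction
      (count-used-between {x} ry p≤n λ {v} p<v v≤n →
        decidable-stable (used? x v) λ ¬used → ¬unused (v , s≤s v≤n , p<v , ¬used))
      (<⇒≱ (subst₂ (λ a b → a + count y n p < b + count x n p)
        (sym (count-full n (proj₁ rx))) (sym (count-full n (proj₁ ry))) (+-monoʳ-< n gap)))

    candidate-exists : ∀ d {k p} → d + k ≡ n → p ≤ n → count y k p < count x k p →
                       ∃[ t ] ∃[ v ] Candidate p t v
    candidate-exists zero refl p≤n gap = candidate-at-end p≤n gap
    candidate-exists (suc d) {k} {p} eq p≤n gap with x k ≤? p
    ... | no xk≰p  = k , x k , inj₁ (subst (k <_) eq (s≤s (m≤n+m k d)) , refl) , ≰⇒> xk≰p , gap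
    ... | yes xk≤p = candidate-exists d (trans (+-suc d k) eq) p≤n
      (+-mono-<-≤ gap (≤-trans ([≤]≤1 (y k) p) (≤-reflexive (sym ([≤]≡1 xk≤p)))))

    -- Compares the numbers of entries in (p , v] among the first k: walking right from a gap,
    -- x acquires no such entry before the gap closes.
    excess : ∀ {p q} → q ≤ n → (∀ {t v} → Candidate p t v → q ≤ v) → ∀ {v} → p ≤ v → v < q →
             ∀ d {k} → d + k ≡ n → count y k p < count x k p →
             count y k v + count x k p ≤ count x k v + count y k p
    excess q≤n minimal p≤v v<q zero refl gap = count-used-between ry p≤v λ {w} p<w w≤v →
      decidable-stable (used? x w) λ ¬used → <⇒≱ (≤-<-trans w≤v v<q)
        (minimal (inj₂ (refl , ≤-trans w≤v (≤-trans (<⇒≤ v<q) q≤n) , λ s<n xs≡w → ¬used (_ , s<n , xs≡w))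
                 , p<w , gap))
    excess {p} q≤n minimal {v} p≤v v<q (suc d) {k} eq gap = +-cancelʳ-≤ ([ x k ≤ v ] + [ y k ≤ v ]) _ _ (begin
      count y k v + count x k p + ([ x k ≤ v ] + [ y k ≤ v ])
        ≡⟨ cong (count y k v + count x k p +_) (+-comm [ x k ≤ v ] _) ⟩
      count y k v + count x k p + ([ y k ≤ v ] + [ x k ≤ v ])
        ≡⟨ interchange (count y k v) _ _ _ ⟩
      count y (suc k) v + (count x k p + [ x k ≤ v ])
        ≡⟨ cong (λ a → count y (suc k) v + (count x k p + a)) same-step ⟩
      count y (suc k) v + count x (suc k) p
        ≤⟨ next ⟩
      count x (suc k) v + count y (suc k) p
        ≤⟨ +-monoʳ-≤ (count x (suc k) v) (+-monoʳ-≤ (count y k p) ([≤]-monoʳ (y k) p≤v)) ⟩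
      count x (suc k) v + (count y k p + [ y k ≤ v ])
        ≡⟨ interchange (count x k v) _ _ _ ⟩
      count x k v + count y k p + ([ x k ≤ v ] + [ y k ≤ v ])  ∎)
      where
      open ≤-Reasoning
      k<n : k < n
      k<n = subst (k <_) eq (s≤s (m≤n+m k d))
      -- An entry of `x` in `(p , v]` here would again be a candidate below `q`.
      same-step : [ x k ≤ v ] ≡ [ x k ≤ p ]
      same-step with x k ≤? p
      ... | yes xk≤p = [≤]≡1 (≤-trans xk≤p p≤v)
      ... | no  xk≰p = [≤]≡0 (<-≤-trans v<q (minimal (inj₁ (k<n , refl) , ≰⇒> xk≰p , gap)))
      next : count y (suc k) v + count x (suc k) p ≤ count x (suc k) v + count y (suc k) p
      next with count y (suc k) p <? count x (suc k) p
      ... | yes gap′ = excess q≤n minimal p≤v v<q d (trans (+-suc d k) eq) gap′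
      -- Once the gap at `p` has closed, dominance at `v` finishes the comparison.
      ... | no ¬gap  = +-mono-≤ (x⊒y v k<n) (≮⇒≥ ¬gap)

    record LastOccurrence (p k : ℕ) : Set where
      field
        i      : ℕ
        i<k    : i < k
        xi≡p   : x i ≡ p
        last-p : ∀ {t} → i < t → t < k → x t ≢ p
        gaps   : ∀ {t} → i < t → t ≤ k → count y t p < count x t p

    extend-last : ∀ {p k} → count y (suc k) p < count x (suc k) p → x k ≢ p →
                  LastOccurrence p k → LastOccurrence p (suc k)
    extend-last {p} {k} gap xk≢p last = record
      { i = i ; i<k = m<n⇒m<1+n i<k ; xi≡p = xi≡p ; last-p = last-p′ ; gaps = gaps′ }
      where
      open LastOccurrence last
      last-p′ : ∀ {t} → i < t → t < suc k → x t ≢ p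
      last-p′ i<t t<1+k with m<1+n⇒m<n∨m≡n t<1+k
      ... | inj₁ t<k  = last-p i<t t<k
      ... | inj₂ refl = xk≢p
      gaps′ : ∀ {t} → i < t → t ≤ suc k → count y t p < count x t p
      gaps′ i<t t≤1+k with m≤n⇒m<n∨m≡n t≤1+k
      ... | inj₁ t<1+k = gaps i<t (m<1+n⇒m≤n t<1+k)
      ... | inj₂ refl  = gap

    -- Walk left from the gap until an entry of `x` equals `p`. An entry above `p` adds nothing to
    -- the count of `x`. For an entry below `p`, agreement at that level forces `y` to have a small
    -- entry there too. Either way the gap persists, and it cannot reach the empty prefix.
    lastOccurrence : ∀ {p} → (∀ {v k} → v < p → k ≤ n → count x k v ≡ count y k v) →
                     ∀ k → k ≤ n → count y k p < count x k p → LastOccurrence p k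
    lastOccurrence {p} agree (suc k) k<n gap with <-cmp (x k) p
    ... | tri≈ _ xk≡p _ = record
      { i = k ; i<k = n<1+n k ; xi≡p = xk≡p
      ; last-p = λ k<t t<1+k → contradiction t<1+k (≤⇒≯ k<t)
      ; gaps = λ k<t t≤1+k → subst (λ t → count y t p < count x t p) (≤-antisym k<t t≤1+k) gap }
    ... | tri< xk<p xk≢p _ = extend-last gap xk≢p (lastOccurrence agree k (<⇒≤ k<n)
      (+-cancelʳ-< 1 _ _ (subst₂ (λ a b → count y k p + a < count x k p + b)
        ([≤]≡1 (≤-trans (count-agree x y (agree xk<p (<⇒≤ k<n)) (agree xk<p k<n) ≤-refl) (<⇒≤ xk<p)))
        ([≤]≡1 (<⇒≤ xk<p)) gap)))
    ... | tri> _ xk≢p p<xk = extend-last gap xk≢p (lastOccurrence agree k (<⇒≤ k<n)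
      (≤-<-trans (m≤m+n (count y k p) _) (<-≤-trans gap (≤-reflexive
        (trans (cong (count x k p +_) ([≤]≡0 p<xk)) (+-identityʳ _))))))

    minLabel : ∀ {v k} → v ≤ n → k ≤ n → count y k v < count x k v →
               ∃[ p ] ∃[ q ] MinLabel n x y p q
    minLabel {v} {k} v≤n k≤n gap
      -- First minimize the level over all prefixes with a gap, then the value over all candidates
      -- at that level.
      with least (λ w → anyUpTo? (λ t → count y t w <? count x t w) (suc n)) v (k , s≤s k≤n , gap)
    ... | p , (t , t<1+n , gap′) , p-least
      with candidate-exists (n ∸ t) (m∸n+n≡m (m<1+n⇒m≤n t<1+n)) (≤-trans (p-least (k , s≤s k≤n , gap)) v≤n) gap′
    ... | s , w , cand@(at-s , _)
      with least (λ q → anyUpTo? (λ t → candidate? p t q) (suc n)) w (s , s≤s (at-position≤ at-s) , cand)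
    ... | q , (j , _ , at-j , p<q , gap-j) , q-least = p , q , record
      { agree = λ {u} {l} u<p l≤n → ≤-antisym
          (≮⇒≥ λ lt → <⇒≱ u<p (p-least (l , s≤s l≤n , lt))) (x⊒y u l≤n)
      ; p<q = p<q ; j = j ; at-j = at-j ; gap = gap-j
      ; minimal = λ {l} at-l p<u lt → q-least (l , s≤s (at-position≤ at-l) , at-l , p<u , lt) }

-- Dominance, exchanges and coverings of sequences

⊒-antisym : ∀ {n x y} → n ⊢ x ⊒ y → n ⊢ y ⊒ x → ∀ {t} → t < n → x t ≡ y t
⊒-antisym x⊒y y⊒x = count-injective λ v k≤n → ≤-antisym (y⊒x v k≤n) (x⊒y v k≤n)

⊒-trans : ∀ {n x y z} → n ⊢ x ⊒ y → n ⊢ y ⊒ z → n ⊢ x ⊒ z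
⊒-trans x⊒y y⊒z v k≤n = ≤-trans (y⊒z v k≤n) (x⊒y v k≤n)

module _ {n : ℕ} {x : ℕ → ℕ} (rx : Rook n x) where

  swap-rook : ∀ {z i j p q} → Swap n x z i j p q → At n x j q → Rook n z
  swap-rook {z} {i} {j} {p} {q} sw at-j = bounded , injective
    where
    open Swap sw

    data View (t : ℕ) : Set where
      is-i  : t ≡ i → z t ≡ q → View t
      is-j  : t ≡ j → z t ≡ p → View t
      other : t ≢ i → t ≢ j → z t ≡ x t → View t

    view : ∀ {t} → t < n → View t
    view {t} t<n with t ≟ i | t ≟ j
    ... | yes refl | _        = is-i refl zi≡q
    ... | no _     | yes refl = is-j refl (zj≡p t<n)
    ... | no t≢i   | no t≢j   = other t≢i t≢j (same t<n t≢i t≢j)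

    p≤n : p ≤ n
    p≤n = subst (_≤ n) xi≡p (proj₁ rx i<n)

    bounded : ∀ {t} → t < n → z t ≤ n
    bounded t<n with view t<n
    ... | is-i _ eq    = subst (_≤ n) (sym eq) (at-value≤ rx at-j)
    ... | is-j _ eq    = subst (_≤ n) (sym eq) p≤n
    ... | other _ _ eq = subst (_≤ n) (sym eq) (proj₁ rx t<n)

    q-only-at-j : ∀ {t} → t < n → t ≢ j → x t ≢ q
    q-only-at-j t<n t≢j xt≡q = t≢j (at-unique rx (m<n⇒n≢0 p<q) (inj₁ (t<n , xt≡q)) at-j)

    p-only-at-i : ∀ {t} → t < n → t ≢ i → p ≢ 0 → x t ≢ p
    p-only-at-i t<n t≢i p≢0 xt≡p =
      t≢i (proj₂ rx t<n i<n (trans xt≡p (sym xi≡p)) (p≢0 ∘ trans (sym xt≡p)))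

    injective : ∀ {s t} → s < n → t < n → z s ≡ z t → z s ≢ 0 → s ≡ t
    injective s<n t<n eq zs≢0 with view s<n | view t<n
    ... | is-i refl _ | is-i refl _ = refl
    ... | is-i _ a | is-j _ b = contradiction (trans (sym b) (trans (sym eq) a)) (<⇒≢ p<q)
    ... | is-i _ a | other _ t≢j b = contradiction (trans (sym b) (trans (sym eq) a)) (q-only-at-j t<n t≢j)
    ... | is-j _ a | is-i _ b = contradiction (trans (sym a) (trans eq b)) (<⇒≢ p<q)
    ... | is-j refl _ | is-j refl _ = refl
    ... | is-j _ a | other t≢i _ b =
      contradiction (trans (sym b) (trans (sym eq) a)) (p-only-at-i t<n t≢i (zs≢0 ∘ trans a))
    ... | other _ s≢j a | is-i _ b = contradiction (trans (sym a) (trans eq b)) (q-only-at-j s<n s≢j)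
    ... | other s≢i _ a | is-j _ b = contradiction (trans (sym a) (trans eq b))
      (p-only-at-i s<n s≢i (zs≢0 ∘ trans (trans eq b)))
    ... | other _ _ a | other _ _ b =
      proj₂ rx s<n t<n (trans (sym a) (trans eq b)) (zs≢0 ∘ trans a)

  -- The label fixes both positions: `q` is positive and so sits at only one place, and `i` is the
  -- last `p` before it.
  cover-unique : ∀ {z z′ p q} → Cover n x z p q → Cover n x z′ p q → ∀ {t} → t < n → z t ≡ z′ t
  cover-unique {z} {z′} {p} {q} cov cov′ = pointwise i≡i′ j≡j′
    where
    module K  = Cover cov
    module K′ = Cover cov′

    j≡j′ : K.j ≡ K′.j
    j≡j′ = at-unique rx (m<n⇒n≢0 K.p<q) K.at-j K′.at-j

    i≡i′ : K.i ≡ K′.i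
    i≡i′ with <-cmp K.i K′.i
    ... | tri≈ _ eq _ = eq
    ... | tri< lt _ _ = contradiction K′.xi≡p (K.last-p lt (subst (K′.i <_) (sym j≡j′) K′.i<j))
    ... | tri> _ _ gt = contradiction K.xi≡p (K′.last-p gt (subst (K.i <_) j≡j′ K.i<j))

    pointwise : K.i ≡ K′.i → K.j ≡ K′.j → ∀ {t} → t < n → z t ≡ z′ t
    pointwise i≡ j≡ {t} t<n with t ≟ K.i | t ≟ K.j
    ... | yes refl | _        = trans K.zi≡q (sym (trans (cong z′ i≡) K′.zi≡q))
    ... | no _     | yes refl =
      trans (K.zj≡p t<n) (sym (trans (cong z′ j≡) (K′.zj≡p (subst (_< n) j≡ t<n))))
    ... | no t≢i   | no t≢j   =
      trans (K.same t<n t≢i t≢j) (sym (K′.same t<n (t≢i ∘ λ e → trans e (sym i≡)) (t≢j ∘ λ e → trans e (sym j≡))))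

  -- A covering inside a covering lies in the same rectangle, where x has no further entries.
  cover-inside-cover : ∀ {z u p q p′ q′} → Cover n x z p q → Cover n x u p′ q′ →
                       n ⊢ u ⊒ z → p′ ≡ p × q′ ≡ q
  cover-inside-cover {z} {u} {p} {q} {p′} {q′} cov cov′ u⊒z = p′≡p , q′≡q
    where
    module K  = Cover cov
    module K′ = Cover cov′

    -- Where `u` has dropped below `x`, so has `z`; hence the rectangle of `u` lies in that of `z`.
    inside-both : ∀ {k v} → k ≤ n → K′.Inside k v → K.Inside k v
    inside-both k≤n in′ = K.inside k≤n (≤-<-trans (u⊒z _ k≤n) (K′.count-drop in′))

    in-start : K.Inside (suc K′.i) p′
    in-start = inside-both K′.i<n ((≤-refl , K′.i<j) , ≤-refl , K′.p<q)

    -- Otherwise the entry `p′` of `x` lies strictly right of `i` at a level in `[p , q)`: `last-p`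
    -- excludes `p` itself, `between` the rest.
    i′≡i : K′.i ≡ K.i
    i′≡i with m≤n⇒m<n∨m≡n (m<1+n⇒m≤n (proj₁ (proj₁ in-start)))
    ... | inj₂ eq  = sym eq
    ... | inj₁ i<i′ with m≤n⇒m<n∨m≡n (proj₁ (proj₂ in-start))
    ...   | inj₂ p≡p′ = contradiction (trans K′.xi≡p (sym p≡p′)) (K.last-p i<i′ (proj₂ (proj₁ in-start)))
    ...   | inj₁ p<p′ = contradiction
      (K.between i<i′ (<⇒≤ (proj₂ (proj₁ in-start))) (inj₁ (K′.i<n , K′.xi≡p)) p<p′)
      (<⇒≱ (proj₂ (proj₂ in-start)))

    p′≡p : p′ ≡ p
    p′≡p = trans (sym K′.xi≡p) (trans (cong x i′≡i) K.xi≡p)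

    q′≤q : q′ ≤ q
    -- The topmost level of the inner rectangle, one below `q′`, lies below `q`.
    q′≤q = top K′.p<q λ p′≤v v<q′ →
      proj₂ (proj₂ (inside-both K′.i<n ((≤-refl , K′.i<j) , p′≤v , v<q′)))
      where
      top : ∀ {a b c} → a < b → (∀ {v} → a ≤ v → v < b → v < c) → b ≤ c
      top {b = suc b} a<1+b f = f (m<1+n⇒m≤n a<1+b) ≤-refl

    q′≡q : q′ ≡ q
    q′≡q = ≤-antisym q′≤q (K.between
      (subst (_< K′.j) i′≡i K′.i<j)
      (proj₂ (proj₁ (inside-both K′.j≤n ((K′.i<j , ≤-refl) , ≤-refl , K′.p<q))))
      K′.at-j (subst (_< q′) p′≡p K′.p<q))

-- The minimal label against other coverings

module _ {n : ℕ} {x y : ℕ → ℕ} {p q : ℕ} (m : MinLabel n x y p q) where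
  private module M = MinLabel m

  -- Inside the rectangle one unit of slack is needed. There `excess` bounds the difference of
  -- counts at `v` from below by the difference at `p`, which is positive by `gaps`.
  minSwap-⊒ : ∀ {z i j} → Rook n x → Rook n y → n ⊢ x ⊒ y → Swap n x z i j p q → q ≤ n →
              (∀ {t} → i < t → t ≤ j → count y t p < count x t p) → n ⊢ z ⊒ y
  minSwap-⊒ {z} rx ry x⊒y sw q≤n gaps {k} v k≤n with Swap.inside? sw k v
  ... | no ¬in = subst (count y k v ≤_) (sym (Swap.count-outside sw k≤n ¬in)) (x⊒y v k≤n)
  ... | yes in′@((i<k , k≤j) , p≤v , v<q) =
    m<1+n⇒m≤n (subst (count y k v <_) (sym (Swap.count-inside sw i<k k≤j p≤v v<q))
      (+-cancelʳ-< (count x k p) _ _ (≤-<-trans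
        (excess rx ry x⊒y q≤n (λ (at-t , p<w , gap) → M.minimal at-t p<w gap)
          p≤v v<q (n ∸ k) (m∸n+n≡m k≤n) (gaps i<k k≤j))
        (+-monoʳ-< (count x k v) (gaps i<k k≤j)))))

  -- A covering with `p′ < p` would lower a count that already agrees with `y`. If `p′ ≡ p`, the
  -- drop at its right end shows a gap of `x` there, so `q′` is among the values minimized by `q`.
  minLabel-≤ : ∀ {w p′ q′} → Cover n x w p′ q′ → n ⊢ w ⊒ y → (p , q) ≤Γ (p′ , q′)
  minLabel-≤ {w} {p′} {q′} cov w⊒y with <-cmp p′ p
  ... | tri< p′<p _ _ = contradiction (sym (M.agree p′<p i<n))
      (<⇒≢ (≤-<-trans (w⊒y p′ i<n) (count-drop ((≤-refl , i<j) , ≤-refl , p<q))))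
    where open Cover cov
  ... | tri≈ _ refl _ = inj₂ (refl , M.minimal at-j p<q
      (≤-<-trans (w⊒y p′ j≤n) (count-drop ((i<j , ≤-refl) , ≤-refl , p<q))))
    where open Cover cov
  ... | tri> _ _ p<p′ = inj₁ p<p′

  -- No gap opens below level `p`, since those counts are unchanged. At level `p` every gap of `z`
  -- is one of `x`, and values other than `p` and `q` have kept their positions, so `q₁` was
  -- available before.
  minLabel-increasing : ∀ {z p₁ q₁} → Cover n x z p q → n ⊢ z ⊒ y →
                        MinLabel n z y p₁ q₁ → (p , q) ≤Γ (p₁ , q₁)
  minLabel-increasing {z} {p₁} {q₁} cov z⊒y m₁ with <-cmp p₁ p
  ... | tri< p₁<p _ _ = contradiction
      (trans (sym (M.agree p₁<p j₁≤n)) (sym (count-outside j₁≤n λ (_ , p≤p₁ , _) → <⇒≱ p₁<p p≤p₁)))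
      (<⇒≢ M₁.gap)
    where
    module M₁ = MinLabel m₁
    open Cover cov
    j₁≤n = at-position≤ M₁.at-j
  ... | tri> _ _ p<p₁ = inj₁ p<p₁
  ... | tri≈ _ refl _ = inj₂ (refl , bound)
    where
    module M₁ = MinLabel m₁
    open Cover cov
    bound : q ≤ q₁
    bound with q₁ ≟ q
    ... | yes refl = ≤-refl
    ... | no q₁≢q  = M.minimal (at-backward (>⇒≢ M₁.p<q) q₁≢q M₁.at-j) M₁.p<q
      (<-≤-trans M₁.gap (swap-⊒ p (at-position≤ M₁.at-j)))

  -- After a covering with a label other than (p , q), the label (p , q) is still available
  -- unless the exchanged rectangle crosses it, which the covering condition forbids.
  module _ {z p′ q′} (cov : Cover n x z p′ q′) (z⊒y : n ⊢ z ⊒ y) (≢label : (p′ , q′) ≢ (p , q)) where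
    open Cover cov

    -- If `p < p′`, a surviving gap at level `p` already bounds the next label below `(p′ , q′)`. If
    -- `p ≡ p′`, the second component decides, so `q` must also survive behind a gap.
    Leftover : Set
    Leftover = (p < p′ × ∃[ k ] (k ≤ n × count y k p < count z k p))
             ⊎ (p ≡ p′ × q < q′ × ∃[ k ] (At n z k q × count y k p < count z k p))

    leftover : Leftover
    leftover with minLabel-≤ cov z⊒y
    ... | inj₁ p<p′ = inj₁ (p<p′ , M.j , at-position≤ M.at-j , subst (count y M.j p <_)
      (sym (count-outside (at-position≤ M.at-j) λ (_ , p′≤p , _) → <⇒≱ p<p′ p′≤p)) M.gap)
    -- The position of `q` is not in `(i , j]`: there `between` would force `q′ ≤ q`.
    ... | inj₂ (refl , q≤q′) = inj₂ (refl , q<q′ , M.j , at-forward (>⇒≢ M.p<q) (<⇒≢ q<q′) M.at-j ,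
      subst (count y M.j p <_) (sym (count-outside (at-position≤ M.at-j)
        λ ((i<k , k≤j) , _) → <⇒≱ q<q′ (between i<k k≤j M.at-j M.p<q))) M.gap)
      where
      q<q′ : q < q′
      q<q′ = ≤∧≢⇒< q≤q′ λ { refl → ≢label refl }

    leftover-gap : ∃[ k ] (k ≤ n × count y k p < count z k p)
    leftover-gap with leftover
    ... | inj₁ (_ , gap) = gap
    ... | inj₂ (_ , _ , k , at-k , gap) = k , at-position≤ at-k , gap

    minLabel-decreasing : ∀ {p₁ q₁} → MinLabel n z y p₁ q₁ → (p₁ , q₁) <Γ (p′ , q′)
    minLabel-decreasing {p₁} m₁ with <-cmp p₁ p | leftover
    ... | tri> _ _ p<p₁ | _ with leftover-gap
    ...   | k , k≤n , gap = contradiction (sym (MinLabel.agree m₁ p<p₁ k≤n)) (<⇒≢ gap)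
    minLabel-decreasing m₁ | tri< p₁<p _ _ | inj₁ (p<p′ , _) = inj₁ (<-trans p₁<p p<p′)
    minLabel-decreasing m₁ | tri< p₁<p _ _ | inj₂ (refl , _) = inj₁ p₁<p
    minLabel-decreasing m₁ | tri≈ _ refl _ | inj₁ (p<p′ , _) = inj₁ p<p′
    minLabel-decreasing m₁ | tri≈ _ refl _ | inj₂ (refl , q<q′ , k , at-k , gap) =
      inj₂ (refl , ≤-<-trans (MinLabel.minimal m₁ at-k M.p<q gap) q<q′)

  minLabel-unique : ∀ {p₁ q₁} → MinLabel n x y p₁ q₁ → p₁ ≡ p × q₁ ≡ q
  minLabel-unique {p₁} m₁ with <-cmp p₁ p
  ... | tri< p₁<p _ _ = contradiction (sym (M.agree p₁<p (at-position≤ (MinLabel.at-j m₁))))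
                                      (<⇒≢ (MinLabel.gap m₁))
  ... | tri> _ _ p<p₁ = contradiction (sym (MinLabel.agree m₁ p<p₁ (at-position≤ M.at-j)))
                                      (<⇒≢ M.gap)
  ... | tri≈ _ refl _ = refl , ≤-antisym (M₁.minimal M.at-j M.p<q M.gap)
                                         (M.minimal M₁.at-j M₁.p<q M₁.gap)
    where module M₁ = MinLabel m₁

-- Filters with one or two survivors

-- Stated for a tabulated `f` so that induction can pass to `f ∘ Fin.suc`. With `f = id` the list is
-- the `allFin n` of `diffPos`.
filter-tabulate-single : ∀ {A : Set} {P : Pred A 0ℓ} (P? : Decidable P) {n} (f : Fin n → A) i →
  P (f i) → (∀ k → k ≢ i → ¬ P (f k)) → filter P? (List.tabulate f) ≡ f i ∷ []
filter-tabulate-single P? f Fin.zero pi ¬p =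
  trans (filter-accept P? pi)
        (cong (f Fin.zero ∷_) (filter-none P? (tabulate⁺ λ k → ¬p (Fin.suc k) λ ())))
filter-tabulate-single P? f (Fin.suc i) pi ¬p =
  trans (filter-reject P? (¬p Fin.zero λ ()))
        (filter-tabulate-single P? (f ∘ Fin.suc) i pi λ k k≢i → ¬p (Fin.suc k) (k≢i ∘ Fin.suc-injective))

filter-tabulate-pair : ∀ {A : Set} {P : Pred A 0ℓ} (P? : Decidable P) {n} (f : Fin n → A) i j →
  i Fin.< j → P (f i) → P (f j) → (∀ k → k ≢ i → k ≢ j → ¬ P (f k)) →
  filter P? (List.tabulate f) ≡ f i ∷ f j ∷ []
filter-tabulate-pair P? f Fin.zero (Fin.suc j) i<j pi pj ¬p =
  trans (filter-accept P? pi)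
        (cong (f Fin.zero ∷_) (filter-tabulate-single P? (f ∘ Fin.suc) j pj
          λ k k≢j → ¬p (Fin.suc k) (λ ()) (k≢j ∘ Fin.suc-injective)))
filter-tabulate-pair P? f (Fin.suc i) (Fin.suc j) i<j pi pj ¬p =
  trans (filter-reject P? (¬p Fin.zero (λ ()) (λ ())))
        (filter-tabulate-pair P? (f ∘ Fin.suc) i j (≤-pred i<j) pi pj
          λ k k≢i k≢j → ¬p (Fin.suc k) (k≢i ∘ Fin.suc-injective) (k≢j ∘ Fin.suc-injective))

-- Vectors as functions on positions

opaque
  -- The 0 past the end is a filler; only positions below `n` are ever compared.
  entry : ∀ {n} → Vec ℕ n → ℕ → ℕ
  entry []       _       = 0
  entry (a ∷ as) zero    = a
  entry (a ∷ as) (suc t) = entry as t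

  entry-toℕ : ∀ {n} (x : Vec ℕ n) i → entry x (toℕ i) ≡ lookup x i
  entry-toℕ (a ∷ x) Fin.zero    = refl
  entry-toℕ (a ∷ x) (Fin.suc i) = entry-toℕ x i

  entry-ext : ∀ {n} (x y : Vec ℕ n) → (∀ {t} → t < n → entry x t ≡ entry y t) → x ≡ y
  entry-ext []      []      eq = refl
  entry-ext (a ∷ x) (b ∷ y) eq = cong₂ _∷_ (eq (s≤s z≤n)) (entry-ext x y (eq ∘ s≤s))

entry-fromℕ< : ∀ {n} (x : Vec ℕ n) {t} (t<n : t < n) → lookup x (fromℕ< t<n) ≡ entry x t
entry-fromℕ< x t<n = trans (sym (entry-toℕ x _)) (cong (entry x) (Fin.toℕ-fromℕ< t<n))

isRook⇒rook : ∀ {n} {x : Vec ℕ n} → IsRook n x → Rook n (entry x)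
isRook⇒rook {n} {x} (bounded , inj) =
    (λ t<n → subst (_≤ n) (entry-fromℕ< x t<n) (bounded (fromℕ< t<n)))
  , λ s<n t<n eq ≢0 → Fin.fromℕ<-injective _ _ s<n t<n
      (inj _ _ (trans (entry-fromℕ< x s<n) (trans eq (sym (entry-fromℕ< x t<n))))
               (≢0 ∘ trans (sym (entry-fromℕ< x s<n))))

rook⇒isRook : ∀ {n} {x : Vec ℕ n} → Rook n (entry x) → IsRook n x
rook⇒isRook {n} {x} (bounded , inj) =
    (λ i → subst (_≤ n) (entry-toℕ x i) (bounded (Fin.toℕ<n i)))
  , λ i j eq ≢0 → Fin.toℕ-injective (inj (Fin.toℕ<n i) (Fin.toℕ<n j)
      (trans (entry-toℕ x i) (trans eq (sym (entry-toℕ x j)))) (≢0 ∘ trans (sym (entry-toℕ x i))))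

-- Exchanges of vectors, generators and labels

module _ {n : ℕ} where

  infix 4 _≽_
  _≽_ : Vec ℕ n → Vec ℕ n → Set
  x ≽ y = n ⊢ entry x ⊒ entry y

  ≽-antisym : ∀ {x y} → x ≽ y → y ≽ x → x ≡ y
  ≽-antisym {x} {y} x≽y y≽x = entry-ext x y (⊒-antisym x≽y y≽x)

  VSwap : Vec ℕ n → Vec ℕ n → ℕ → ℕ → ℕ → ℕ → Set
  VSwap x z = Swap n (entry x) (entry z)

  VCover : Vec ℕ n → Vec ℕ n → ℕ → ℕ → Set
  VCover x z = Cover n (entry x) (entry z)

  VMinLabel : Vec ℕ n → Vec ℕ n → ℕ → ℕ → Set
  VMinLabel x y = MinLabel n (entry x) (entry y)

  entries-agree : ∀ {x z : Vec ℕ n} {i j} →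
                  (∀ k → toℕ k ≢ i → toℕ k ≢ j → lookup z k ≡ lookup x k) →
                  ∀ {t} → t < n → t ≢ i → t ≢ j → entry z t ≡ entry x t
  entries-agree {x} {z} same t<n t≢i t≢j = begin
    entry z _              ≡⟨ entry-fromℕ< z t<n ⟨
    lookup z (fromℕ< t<n)  ≡⟨ same _ (t≢i ∘ trans (sym toℕ≡t)) (t≢j ∘ trans (sym toℕ≡t)) ⟩
    lookup x (fromℕ< t<n)  ≡⟨ entry-fromℕ< x t<n ⟩
    entry x _              ∎
    where
    open ≡-Reasoning
    toℕ≡t = Fin.toℕ-fromℕ< t<n

  gen1⇒swap : ∀ {x z} → Gen1 n x z → ∃[ i ] ∃[ p ] ∃[ q ] VSwap x z i n p q
  gen1⇒swap {x} {z} (i , xi<zi , same) = toℕ i , lookup x i , lookup z i , record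
    { i<j  = Fin.toℕ<n i
    ; j≤n  = ≤-refl
    ; p<q  = xi<zi
    ; xi≡p = entry-toℕ x i
    ; zi≡q = entry-toℕ z i
    -- A type 1 move uses the extra position `n`, where the guarded conditions are vacuous.
    ; xj≡q = λ n<n → contradiction n<n (<-irrefl refl)
    ; zj≡p = λ n<n → contradiction n<n (<-irrefl refl)
    ; same = entries-agree λ k k≢i _ → same k (k≢i ∘ cong toℕ) }

  gen2⇒swap : ∀ {x z} → Gen2 n x z → ∃[ i ] ∃[ j ] ∃[ p ] ∃[ q ] VSwap x z i j p q
  gen2⇒swap {x} {z} (i , j , i<j , zi≡xj , zj≡xi , zj<zi , same) =
    toℕ i , toℕ j , lookup x i , lookup x j , record
    { i<j  = i<j
    ; j≤n  = <⇒≤ (Fin.toℕ<n j)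
    ; p<q  = subst₂ _<_ zj≡xi zi≡xj zj<zi
    ; xi≡p = entry-toℕ x i
    ; zi≡q = trans (entry-toℕ z i) zi≡xj
    ; xj≡q = λ _ → entry-toℕ x j
    ; zj≡p = λ _ → trans (entry-toℕ z j) zj≡xi
    ; same = entries-agree λ k k≢i k≢j → same k (k≢i ∘ cong toℕ) (k≢j ∘ cong toℕ) }

  -- Every generator is an exchange and so lowers counts. The converse, `≽⇒leB`, comes from the
  -- greedy chain.
  leB⇒≽ : ∀ {x y} → LeB n x y → x ≽ y
  leB⇒≽ ε = λ _ _ → ≤-refl
  leB⇒≽ ((_ , _ , inj₁ g) ◅ rest) = let _ , _ , _ , sw = gen1⇒swap g in
    ⊒-trans (Swap.swap-⊒ sw) (leB⇒≽ rest)
  leB⇒≽ ((_ , _ , inj₂ g) ◅ rest) = let _ , _ , _ , _ , sw = gen2⇒swap g in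
    ⊒-trans (Swap.swap-⊒ sw) (leB⇒≽ rest)

  lookup-same : ∀ {x z : Vec ℕ n} {i j p q} → VSwap x z i j p q →
                ∀ k → toℕ k ≢ i → toℕ k ≢ j → lookup z k ≡ lookup x k
  lookup-same {x} {z} sw k k≢i k≢j = trans (sym (entry-toℕ z k))
    (trans (Swap.same sw (Fin.toℕ<n k) k≢i k≢j) (entry-toℕ x k))

  data SwapType (x z : Vec ℕ n) (p q : ℕ) : Set where
    type1 : (i : Fin n) → lookup x i ≡ p → lookup z i ≡ q →
            (∀ k → k ≢ i → lookup z k ≡ lookup x k) → SwapType x z p q
    type2 : (i j : Fin n) → i Fin.< j → lookup x i ≡ p → lookup z i ≡ q →
            lookup x j ≡ q → lookup z j ≡ p →
            (∀ k → k ≢ i → k ≢ j → lookup z k ≡ lookup x k) → SwapType x z p q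

  swapType : ∀ {x z i j p q} → VSwap x z i j p q → SwapType x z p q
  swapType {x} {z} {i} {j} sw with j <? n
  ... | no j≮n = type1 (fromℕ< i<n) (trans (entry-fromℕ< x i<n) xi≡p) (trans (entry-fromℕ< z i<n) zi≡q)
    λ k k≢i → lookup-same sw k
      (λ eq → k≢i (Fin.toℕ-injective (trans eq (sym (Fin.toℕ-fromℕ< i<n)))))
      (λ { refl → j≮n (Fin.toℕ<n k) })
    where open Swap sw
  ... | yes j<n = type2 (fromℕ< i<n) (fromℕ< j<n)
    (subst₂ _<_ (sym (Fin.toℕ-fromℕ< i<n)) (sym (Fin.toℕ-fromℕ< j<n)) i<j)
    (trans (entry-fromℕ< x i<n) xi≡p) (trans (entry-fromℕ< z i<n) zi≡q)
    (trans (entry-fromℕ< x j<n) (xj≡q j<n)) (trans (entry-fromℕ< z j<n) (zj≡p j<n))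
    λ k k≢i k≢j → lookup-same sw k
      (λ eq → k≢i (Fin.toℕ-injective (trans eq (sym (Fin.toℕ-fromℕ< i<n)))))
      (λ eq → k≢j (Fin.toℕ-injective (trans eq (sym (Fin.toℕ-fromℕ< j<n)))))
    where open Swap sw

  swap⇒gen : ∀ {x z i j p q} → VSwap x z i j p q → Gen1 n x z ⊎ Gen2 n x z
  swap⇒gen {x} {z} {p = p} {q} sw with swapType {x} {z} sw
  ... | type1 i xi zi same = inj₁ (i , subst₂ _<_ (sym xi) (sym zi) (Swap.p<q sw) , same)
  ... | type2 i j i<j xi zi xj zj same =
    inj₂ (i , j , i<j , trans zi (sym xj) , trans zj (sym xi) , subst₂ _<_ (sym zj) (sym zi) (Swap.p<q sw) , same)

  swap⇒label : ∀ {x z i j p q} → VSwap x z i j p q → FLabel n x z ≡ (p , q)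
  swap⇒label {x} {z} {p = p} {q} sw with swapType {x} {z} sw
  ... | type1 i refl refl same
    rewrite filter-tabulate-single (λ k → ¬? (lookup x k ≟ lookup z k)) id i
              (<⇒≢ (Swap.p<q sw)) (λ k k≢i ≢ → ≢ (sym (same k k≢i))) = refl
  ... | type2 i j i<j refl refl xj zj same
    rewrite filter-tabulate-pair (λ k → ¬? (lookup x k ≟ lookup z k)) id i j i<j
              (<⇒≢ (Swap.p<q sw)) (λ eq → <⇒≢ (Swap.p<q sw) (trans (sym zj) (trans (sym eq) xj)))
              (λ k k≢i k≢j ≢ → ≢ (sym (same k k≢i k≢j))) = cong (lookup x i ,_) xj

  exchange : (x : Vec ℕ n) (i j p q : ℕ) → ℕ → ℕ
  exchange x i j p q t with t ≟ i | t ≟ j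
  ... | yes _ | _     = q
  ... | no _  | yes _ = p
  ... | no _  | no _  = entry x t

  swapped : (x : Vec ℕ n) (i j p q : ℕ) → Vec ℕ n
  swapped x i j p q = tabulate (exchange x i j p q ∘ toℕ)

  entry-swapped : ∀ x i j p q {t} → t < n → entry (swapped x i j p q) t ≡ exchange x i j p q t
  entry-swapped x i j p q {t} t<n = begin
    entry (swapped x i j p q) t             ≡⟨ entry-fromℕ< (swapped x i j p q) t<n ⟨
    lookup (swapped x i j p q) (fromℕ< t<n) ≡⟨ lookup∘tabulate _ (fromℕ< t<n) ⟩
    exchange x i j p q (toℕ (fromℕ< t<n))   ≡⟨ cong (exchange x i j p q) (Fin.toℕ-fromℕ< t<n) ⟩
    exchange x i j p q t                    ∎
    where open ≡-Reasoning

  swapped-swap : ∀ {x i j p q} → i < j → j ≤ n → p < q → entry x i ≡ p → (j < n → entry x j ≡ q) →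
                 VSwap x (swapped x i j p q) i j p q
  swapped-swap {x} {i} {j} {p} {q} i<j j≤n p<q xi≡p xj≡q = record
    { i<j = i<j ; j≤n = j≤n ; p<q = p<q ; xi≡p = xi≡p ; xj≡q = xj≡q
    ; zi≡q = trans (entry-swapped x i j p q (<-≤-trans i<j j≤n)) exchange-i
    ; zj≡p = λ j<n → trans (entry-swapped x i j p q j<n) exchange-j
    ; same = λ t<n t≢i t≢j → trans (entry-swapped x i j p q t<n) (exchange-other t≢i t≢j) }
    where
    exchange-i : exchange x i j p q i ≡ q
    exchange-i with i ≟ i
    ... | yes _  = refl
    ... | no i≢i = contradiction refl i≢i
    exchange-j : exchange x i j p q j ≡ p
    exchange-j with j ≟ i | j ≟ j
    ... | yes j≡i | _     = contradiction j≡i (>⇒≢ i<j)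
    ... | no _    | yes _ = refl
    ... | no _    | no j≢j = contradiction refl j≢j
    exchange-other : ∀ {t} → t ≢ i → t ≢ j → exchange x i j p q t ≡ entry x t
    exchange-other {t} t≢i t≢j with t ≟ i | t ≟ j
    ... | yes t≡i | _      = contradiction t≡i t≢i
    ... | no _    | yes t≡j = contradiction t≡j t≢j
    ... | no _    | no _   = refl

  -- The least atom and the greedy chain

  ≽-gap : ∀ {x y} → Rook n (entry x) → Rook n (entry y) → x ≽ y → x ≢ y →
          ∃[ v ] ∃[ k ] (v ≤ n × k ≤ n × count (entry y) k v < count (entry x) k v)
  ≽-gap {x} {y} rx ry x≽y x≢y
    with anyUpTo? (λ v → anyUpTo? (λ k → count (entry y) k v <? count (entry x) k v) (suc n)) (suc n)
  ... | yes (v , v<1+n , k , k<1+n , gap) = v , k , m<1+n⇒m≤n v<1+n , m<1+n⇒m≤n k<1+n , gap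
  -- With no gap at levels up to `n` the dominance also holds in reverse, because above `n` both
  -- counts equal `k`.
  ... | no ¬gap = contradiction (≽-antisym x≽y y≽x) x≢y
    where
    all-counted : ∀ {z k v} → Rook n z → k ≤ n → n < v → count z k v ≡ k
    all-counted {k = k} rz k≤n n<v =
      count-full k λ t<k → ≤-trans (proj₁ rz (<-≤-trans t<k k≤n)) (<⇒≤ n<v)
    y≽x : y ≽ x
    y≽x {k} v k≤n with v ≤? n
    ... | yes v≤n = ≮⇒≥ λ gap → ¬gap (v , s≤s v≤n , k , s≤s k≤n , gap)
    ... | no  v≰n = ≤-reflexive (trans (all-counted rx k≤n (≰⇒> v≰n)) (sym (all-counted ry k≤n (≰⇒> v≰n))))

  record MinAtom (x y : Vec ℕ n) : Set where
    field
      {p q}    : ℕ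
      z        : Vec ℕ n
      minimal  : VMinLabel x y p q
      cover    : VCover x z p q
      rook     : Rook n (entry z)
      z≽y      : z ≽ y

  -- Exchange `q` with the last `p` before it. The gaps all the way from `i` to `j` give both the
  -- covering condition and dominance over `y`.
  minLabel⇒minAtom : ∀ {x y p q} → Rook n (entry x) → Rook n (entry y) → x ≽ y →
                     VMinLabel x y p q → MinAtom x y
  minLabel⇒minAtom {x} {y} {p} {q} rx ry x≽y m = record
    { z = swapped x i j p q
    ; minimal = m
    ; cover = record
      { i = i ; j = j ; swap = sw ; at-j = at-j ; last-p = last-p
      ; between = λ i<t t≤j at-t p<v → minimal at-t p<v (gaps i<t t≤j) }
    ; rook = swap-rook rx sw at-j
    ; z≽y = minSwap-⊒ m rx ry x≽y sw (at-value≤ rx at-j) gaps }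
    where
    open MinLabel m
    open LastOccurrence (lastOccurrence rx ry x≽y agree j (at-position≤ at-j) gap)
      renaming (i<k to i<j)
    xj≡q : j < n → entry x j ≡ q
    xj≡q j<n with at-j
    ... | inj₁ (_ , eq)    = eq
    ... | inj₂ (refl , _)  = contradiction j<n (<-irrefl refl)
    sw : VSwap x (swapped x i j p q) i j p q
    sw = swapped-swap i<j (at-position≤ at-j) p<q xi≡p xj≡q

  opaque
    minAtom : ∀ {x y} → Rook n (entry x) → Rook n (entry y) → x ≽ y → x ≢ y → MinAtom x y
    minAtom rx ry x≽y x≢y =
      let _ , _ , v≤n , k≤n , gap = ≽-gap rx ry x≽y x≢y
          _ , _ , m               = minLabel rx ry x≽y v≤n k≤n gap
      in minLabel⇒minAtom rx ry x≽y m

  -- Chains that take the least atom at every step, with the data on which increase, uniqueness and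
  -- lexicographic minimality are proved by induction.
  data Greedy (y : Vec ℕ n) : Vec ℕ n → List (Vec ℕ n) → Set where
    done : Greedy y y []
    step : ∀ {x z zs p q} → Rook n (entry x) → Rook n (entry z) →
           VMinLabel x y p q → VCover x z p q → z ≽ y → Greedy y z zs → Greedy y x (z ∷ zs)

  -- Termination measure of the greedy construction. An exchange lowers it strictly at prefix
  -- `suc i` and threshold `p`, a corner of its rectangle.
  total : Vec ℕ n → ℕ
  total x = sumBelow (λ k → sumBelow (count (entry x) k) (suc n)) (suc n)

  total-decreasing : ∀ {x z i j p q} → Rook n (entry x) → VSwap x z i j p q → total z < total x
  total-decreasing {x} {z} {i} {p = p} rx sw = sumBelow-mono-< (suc n)
    (λ k<1+n → sumBelow-mono-≤ (suc n) λ {v} _ → swap-⊒ v (m<1+n⇒m≤n k<1+n))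
    (s≤s i<n)
    (sumBelow-mono-< (suc n) (λ {v} _ → swap-⊒ v i<n)
      (s≤s (subst (_≤ n) xi≡p (proj₁ rx i<n)))
      (count-drop ((≤-refl , i<j) , ≤-refl , p<q)))
    where open Swap sw

  _≟ⱽ_ : (x y : Vec ℕ n) → Dec (x ≡ y)
  _≟ⱽ_ = ≡-dec _≟_

  greedy-exists : ∀ {x y} → Rook n (entry x) → Rook n (entry y) → x ≽ y → ∃[ c ] Greedy y x c
  greedy-exists {x} rx ry x≽y = go rx ry x≽y (<-wellFounded (total x))
    where
    go : ∀ {x y} → Rook n (entry x) → Rook n (entry y) → x ≽ y → Acc _<_ (total x) → ∃[ c ] Greedy y x c
    go {x} {y} rx ry x≽y (acc rec) with x ≟ⱽ y
    ... | yes refl = [] , done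
    ... | no x≢y with minAtom rx ry x≽y x≢y
    ... | atom with go rook ry z≽y (rec (total-decreasing {z = z} rx (Cover.swap cover)))
      where open MinAtom atom
    ... | c , g = z ∷ c , step rx rook minimal cover z≽y g
      where open MinAtom atom

  -- Coverings of the order

  cover⇒step : ∀ {x z p q} → Rook n (entry x) → Rook n (entry z) → VCover x z p q → Step n x z
  cover⇒step {x} {z} rx rz cov = rook⇒isRook {x = x} rx , rook⇒isRook {x = z} rz , swap⇒gen {x} {z} (Cover.swap cov)

  greedy⇒leB : ∀ {x y c} → Greedy y x c → LeB n x y
  greedy⇒leB done = ε
  greedy⇒leB (step rx rz _ cov _ g) = cover⇒step rx rz cov ◅ greedy⇒leB g

  ≽⇒leB : ∀ {x y} → Rook n (entry x) → Rook n (entry y) → x ≽ y → LeB n x y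
  ≽⇒leB rx ry x≽y = greedy⇒leB (proj₂ (greedy-exists rx ry x≽y))

  cover-≢ : ∀ {x z : Vec ℕ n} {p q} → VCover x z p q → x ≢ z
  cover-≢ {x} cov refl = <⇒≢ p<q (trans (sym xi≡p) zi≡q)
    where open Cover cov

  -- For `w` strictly between, the least atom `u` of `[x , w]` is a covering below `z`. By
  -- `cover-inside-cover` it has the same label, so `u ≡ z`, which puts `z` below `w`.
  cover⇒covers : ∀ {x z p q} → Rook n (entry x) → Rook n (entry z) → VCover x z p q → Covers n x z
  cover⇒covers {x} {z} {p} {q} rx rz cov = rook⇒isRook {x = x} rx , rook⇒isRook {x = z} rz ,
    ((cover⇒step rx rz cov ◅ ε) , cover-≢ {x} {z} cov) , nothing-between
    where
    nothing-between : ∀ w → IsRook n w → LtB n x w → LtB n w z → ⊥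
    nothing-between w rw (x≤w , x≢w) (w≤z , w≢z) = w≢z (≽-antisym (leB⇒≽ w≤z) (subst (_≽ w) u≡z u≽w))
      where
      open MinAtom (minAtom rx (isRook⇒rook {x = w} rw) (leB⇒≽ x≤w) x≢w)
        renaming (z to u; cover to cov′; z≽y to u≽w; p to p′; q to q′)
      labels : p′ ≡ p × q′ ≡ q
      labels = cover-inside-cover rx cov cov′ (⊒-trans u≽w (leB⇒≽ w≤z))
      u≡z : u ≡ z
      u≡z = entry-ext u z (cover-unique rx
        (subst₂ (VCover x u) (proj₁ labels) (proj₂ labels) cov′) cov)

  record CoverData (x z : Vec ℕ n) : Set where
    field
      {p q} : ℕ
      rx    : Rook n (entry x)
      rz    : Rook n (entry z)
      cover : VCover x z p q

  -- The least atom of the interval must be its top, since nothing lies strictly between.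
  covers⇒cover : ∀ {x z} → Covers n x z → CoverData x z
  covers⇒cover {x} {w} (irx , irw , (x≤w , x≢w) , nothing-between) = compare (z ≟ⱽ w)
    where
    rx = isRook⇒rook {x = x} irx
    rw = isRook⇒rook {x = w} irw
    open MinAtom (minAtom rx rw (leB⇒≽ x≤w) x≢w)

    compare : Dec (z ≡ w) → CoverData x w
    compare (yes z≡w) = record { rx = rx ; rz = rw ; cover = subst (λ v → VCover x v p q) z≡w cover }
    compare (no z≢w)  = contradiction (≽⇒leB rook rw z≽y , z≢w)
      (nothing-between z (rook⇒isRook {x = z} rook)
        ((cover⇒step rx rook cover ◅ ε) , cover-≢ {x} {z} cover))

  -- Labels of chains and the EL property

  chain⇒≽ : ∀ {x y} c → MaxChain n x c y → x ≽ y
  chain⇒≽ [] refl = λ _ _ → ≤-refl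
  chain⇒≽ (z ∷ c) ((_ , _ , (x≤z , _) , _) , ch) = ⊒-trans (leB⇒≽ x≤z) (chain⇒≽ c ch)

  F : Vec ℕ n → Vec ℕ n → Γ
  F = FLabel n

  greedy⇒chain : ∀ {x y c} → Greedy y x c → MaxChain n x c y
  greedy⇒chain done = refl
  greedy⇒chain (step rx rz _ cov _ g) = cover⇒covers rx rz cov , greedy⇒chain g

  label : ∀ {x z p q} → VCover x z p q → F x z ≡ (p , q)
  label {x} {z} cov = swap⇒label {x} {z} (Cover.swap cov)

  greedy-increasing : ∀ {x y c} → Greedy y x c → Increasing (JH F x c)
  greedy-increasing done = []
  greedy-increasing (step _ _ _ _ _ done) = [-]
  greedy-increasing {x} (step {z = z} _ _ m cov z≽y g@(step {z = z′} _ _ m′ cov′ _ _)) =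
    subst₂ _≤Γ_ (sym (label {x} {z} cov)) (sym (label {z} {z′} cov′)) (minLabel-increasing m cov z≽y m′)
    ∷ greedy-increasing g

  minLabel-irrefl : ∀ {x : Vec ℕ n} {p q} → ¬ VMinLabel x x p q
  minLabel-irrefl m = <-irrefl refl (MinLabel.gap m)

  _≟Γ_ : (a b : Γ) → Dec (a ≡ b)
  _≟Γ_ = Product.≡-dec _≟_ _≟_

  greedy-unique : ∀ {x y c c′} → Greedy y x c → Greedy y x c′ → c ≡ c′
  greedy-unique done done = refl
  greedy-unique {x} done (step _ _ m _ _ _) = contradiction m (minLabel-irrefl {x})
  greedy-unique {x} (step _ _ m _ _ _) done = contradiction m (minLabel-irrefl {x})
  greedy-unique {x} (step {z = z} rx _ m cov _ g) (step {z = z′} _ _ m′ cov′ _ g′) with minLabel-unique m m′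
  ... | refl , refl with entry-ext z z′ (cover-unique rx cov cov′)
  ... | refl = cong (z ∷_) (greedy-unique g g′)

  -- The first label is at most that of any other chain. If they are equal, the label determines the
  -- atom and the tails are compared.
  greedy-lexMin : ∀ {x y c} → Greedy y x c → ∀ c′ → MaxChain n x c′ y → JH F x c ≤Lex JH F x c′
  greedy-lexMin done c′ ch = []≤
  greedy-lexMin {x} (step _ _ m _ _ _) [] refl = contradiction m (minLabel-irrefl {x})
  greedy-lexMin {x} {y} (step {z = z} {p = p} {q} rx _ m cov _ g) (w ∷ ws) (cw , ch)
    with covers⇒cover cw
  ... | record { p = p′ ; q = q′ ; cover = cov′ }
    rewrite label {x} {z} cov | label {x} {w} cov′ with minLabel-≤ m cov′ (chain⇒≽ ws ch)
  ... | inj₁ p<p′ = here (inj₁ p<p′)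
  ... | inj₂ (refl , q≤q′) with m≤n⇒m<n∨m≡n q≤q′
  ...   | inj₁ q<q′ = here (inj₂ (refl , q<q′))
  ...   | inj₂ refl with entry-ext z w (cover-unique rx cov cov′)
  ...     | refl = there (greedy-lexMin g ws ch)

  <Γ⇒≱Γ : ∀ {a b} → a <Γ b → ¬ b ≤Γ a
  <Γ⇒≱Γ (inj₁ p<r) (inj₁ r<p) = <-asym p<r r<p
  <Γ⇒≱Γ (inj₁ p<r) (inj₂ (refl , _)) = <-irrefl refl p<r
  <Γ⇒≱Γ (inj₂ (refl , _)) (inj₁ r<p) = <-irrefl refl r<p
  <Γ⇒≱Γ (inj₂ (_ , q<s)) (inj₂ (_ , s≤q)) = <⇒≱ q<s s≤q

  increasing-tail : ∀ {a as} → Increasing (a ∷ as) → Increasing as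
  increasing-tail [-]       = []
  increasing-tail (_ ∷ inc) = inc

  -- By induction the tail is greedy, so its first label is the minimal one above `w`. If `w` is not
  -- the least atom, `minLabel-decreasing` makes that label smaller than the one just used, against
  -- increase.
  increasing⇒greedy : ∀ {x y} → Rook n (entry y) → ∀ c → MaxChain n x c y → Increasing (JH F x c) → Greedy y x c
  increasing⇒greedy ry [] refl inc = done
  increasing⇒greedy {x} {y} ry (w ∷ ws) (cw , ch) inc
    with covers⇒cover cw | increasing⇒greedy ry ws ch (increasing-tail inc)
  ... | record { p = p′ ; q = q′ ; rx = rx ; rz = rw ; cover = cov } | g
    with minAtom rx ry (⊒-trans (Cover.swap-⊒ cov) (chain⇒≽ ws ch))
      (λ { refl → cover-≢ {x} {w} cov (≽-antisym (Cover.swap-⊒ cov) (chain⇒≽ ws ch)) })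
  ... | record { p = p ; q = q ; minimal = m } with (p′ , q′) ≟Γ (p , q)
  ...   | yes refl = step rx rw m cov (chain⇒≽ ws ch) g
  ...   | no ≢label with g
  -- Here `w` is already `y`, and the leftover gap would be a gap of `y` over itself.
  ...     | done with leftover-gap m cov (chain⇒≽ ws ch) ≢label
  ...       | _ , _ , gap = contradiction gap (<-irrefl refl)
  increasing⇒greedy {x} ry (w ∷ w′ ∷ ws) (cw , ch) (le ∷ inc)
      | record { cover = cov } | _ | record { minimal = m } | no ≢label | step _ _ m′ cov′ _ _ =
    contradiction (subst₂ _≤Γ_ (label {x} {w} cov) (label {w} {w′} cov′) le)
      (<Γ⇒≱Γ (minLabel-decreasing m cov (chain⇒≽ (w′ ∷ ws) ch) ≢label m′))

theorem3p2 : (n : ℕ) → IsELLabeling n (FLabel n)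
theorem3p2 n x y irx iry (x≤y , _) with greedy-exists (isRook⇒rook {x = x} irx) ry (leB⇒≽ x≤y)
  where
  ry : Rook n (entry y)
  ry = isRook⇒rook {x = y} iry
... | c , g = c , greedy⇒chain g , greedy-increasing g
  , (λ c′ ch inc → greedy-unique (increasing⇒greedy (isRook⇒rook {x = y} iry) c′ ch inc) g)
  , greedy-lexMin g
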